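{- Let $p>3$ be a prime and let $\mathcal{O}=\mathbb{Z}[\omega]$ be an order in an imaginary quadratic field $K$. Every $\mathcal{O}$-oriented supersingular elliptic curve $(E,\iota)$ over $\overline{\mathbb{F}}_p$ admits an $\mathcal{O}$-twisting endomorphism.
   Context: $\operatorname{End}(E)$ denotes the full (geometric) endomorphism ring. Let $K$ be an imaginary quadratic field in which $p$ does not split. A $K$-orientation on a supersingular elliptic curve $E/\overline{\mathbb{F}}_p$ is an embedding $\iota:K\hookrightarrow\operatorname{End}(E)\otimes_{\mathbb{Z}}\mathbb{Q}$. It is $\mathcal{O}$-primitive, for an order $\mathcal{O}\subseteq K$, if $\iota(K)\cap\operatorname{End}(E)=\iota(\mathcal{O})$. An $\mathcal{O}$-oriented supersingular elliptic curve is a pair $(E,\iota)$ with $\iota$ an $\mathcal{O}$-primitive $K$-orientation on $E$. The conjugate orientation $\widehat{\iota}$ is defined by $\widehat{\iota}(x)=\iota(\overline{x})$ for all $x\in\mathcal{O}$, where $\overline{x}$ is the Galois conjugate of $x$. With $\mathcal{O}=\mathbb{Z}[\omega]$, an $\mathcal{O}$-twisting endomorphism of $(E,\iota)$ is an $\alpha\in\operatorname{End}(E)$ with $\widehat{\iota}(\omega)\circ\alpha=\alpha\circ\iota(\omega)$. -}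

module Defs where

open import Level using (Level; _⊔_; 0ℓ) renaming (suc to lsuc)
open import Algebra.Bundles using (RawRing; CommutativeRing; AbelianGroup; Ring)
open import Algebra.Structures using (IsAbelianGroup)
open import Algebra.Morphism.Structures using (module GroupMorphisms; module RingMorphisms)
import Algebra.Morphism.Construct.Composition as Compose
import Algebra.Morphism.Construct.Identity as Identity
import Algebra.Definitions.RawMonoid as RawMult
import Algebra.Definitions.RawSemiring as RawExp
import Algebra.Properties.AbelianGroup as AbelianGroupProperties
import Algebra.Properties.CommutativeSemigroup as CommutativeSemigroupProperties
import Algebra.Properties.Semiring.Exp as Exp
open import Data.Fin.Base using (Fin; zero; suc)
open import Data.Integer.Base as ℤ using (ℤ; -[1+_])
open import Data.List.Base as List using (List; []; _∷_)
open import Data.Nat.Base as ℕ using (ℕ; zero; suc; NonZero)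
import Data.Nat.Properties as ℕₚ
open import Data.Product.Base using (Σ; ∃; _×_; _,_; proj₁; proj₂)
open import Data.Rational.Base as ℚ using (ℚ; 0ℚ; 1ℚ)
open import Data.Sum.Base using (_⊎_)
open import Data.Vec.Base as Vec using (Vec; []; _∷_)
open import Data.Vec.Functional using (Vector)
open import Function.Base using (_∘_; id)
open import Function.Bundles using (_⇔_)
open import Relation.Binary.Core using (_Preserves_⟶_)
open import Relation.Binary.Definitions using (Decidable)
open import Relation.Binary.PropositionalEquality as ≡ using (_≡_)
import Relation.Binary.Reasoning.Setoid as SetoidReasoning
open import Relation.Nullary.Negation using (¬_)
open import Relation.Unary using (Pred; _∈_; _⊆_; _≐_)

private
  variable
    c ℓ : Level

------------------------------------------------------------------------
-- Generalities on rings

module _ (R : RawRing c ℓ) where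
  open RawRing R
  open RawMult +-rawMonoid using () renaming (_×_ to _·_)

  -- The value at x of the monic polynomial c₀ + c₁ X + … + cₙ₋₁ Xⁿ⁻¹ + Xⁿ.
  evalMonic : List Carrier → Carrier → Carrier
  evalMonic []       x = 1#
  evalMonic (a ∷ as) x = a + x * evalMonic as x

  fromℤ : ℤ → Carrier
  fromℤ (ℤ.+ n)  = n · 1#
  fromℤ -[1+ n ] = - (suc n · 1#)

-- R ⊗ ℚ as the localisation of R at the positive integers.  The factor t
-- in the equality is what makes this correct even if R has torsion.
record Fraction (A : Set c) : Set c where
  constructor _/_
  field
    num             : A
    den             : ℕ
    .{{den-nonZero}} : NonZero den

infix 10 _⊗ℚ

_⊗ℚ : Ring c ℓ → RawRing c ℓ
R ⊗ℚ = record
  { Carrier = Fraction Carrier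
  ; _≈_     = λ { (a / m) (b / n) →
                  ∃ λ t → NonZero t × t · (n · a) ≈ t · (m · b) }
  ; _+_     = λ { (a / m) (b / n) →
                  _/_ (n · a + m · b) (m ℕ.* n) {{ℕₚ.m*n≢0 m n}} }
  ; _*_     = λ { (a / m) (b / n) → _/_ (a * b) (m ℕ.* n) {{ℕₚ.m*n≢0 m n}} }
  ; -_      = λ { (a / m) → (- a) / m }
  ; 0#      = 0# / 1
  ; 1#      = 1# / 1
  }
  where
  open Ring R
  open RawMult +-rawMonoid using () renaming (_×_ to _·_)

------------------------------------------------------------------------
-- Imaginary quadratic fields

-- a + b √-d.  Every imaginary quadratic field is ℚ(√-d) for some d ≥ 1, and
-- conversely -d is never a square in ℚ; d need not be squarefree.
record ℚ[√-_] (d : ℕ) : Set where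
  constructor _+_√
  field
    re im : ℚ

conj : ∀ {d} → ℚ[√- d ] → ℚ[√- d ]
conj (a + b √) = a + (ℚ.- b) √

ℚ[√-_]-rawRing : ℕ → RawRing 0ℓ 0ℓ
ℚ[√- d ]-rawRing = record
  { Carrier = ℚ[√- d ]
  ; _≈_     = _≡_
  ; _+_     = λ { (a + b √) (a′ + b′ √) → (a ℚ.+ a′) + (b ℚ.+ b′) √ }
  ; _*_     = λ { (a + b √) (a′ + b′ √) →
                  (a ℚ.* a′ ℚ.- (ℤ.+ d ℚ./ 1) ℚ.* (b ℚ.* b′))
                  + (a ℚ.* b′ ℚ.+ b ℚ.* a′) √ }
  ; -_      = λ { (a + b √) → (ℚ.- a) + (ℚ.- b) √ }
  ; 0#      = 0ℚ + 0ℚ √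
  ; 1#      = 1ℚ + 0ℚ √
  }

module _ {d : ℕ} where
  private
    K = ℚ[√- d ]
    rawK = ℚ[√- d ]-rawRing
  open RawRing rawK
  open RawMult +-rawMonoid using (sum) renaming (_×_ to _·_)

  -- The ring of integers of K.
  𝓞 : Pred K 0ℓ
  𝓞 x = ∃ λ (as : List ℤ) → evalMonic rawK (List.map (fromℤ rawK) as) x ≈ 0#

  record IsPrimeIdealAbove (p : ℕ) (𝔭 : Pred K 0ℓ) : Set where
    field
      ⊆𝓞        : 𝔭 ⊆ 𝓞
      0∈        : 0# ∈ 𝔭
      +-closed  : ∀ {x y} → x ∈ 𝔭 → y ∈ 𝔭 → x + y ∈ 𝔭
      *-closed  : ∀ {x y} → x ∈ 𝓞 → y ∈ 𝔭 → x * y ∈ 𝔭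
      1∉        : ¬ 1# ∈ 𝔭
      prime     : ∀ {x y} → x ∈ 𝓞 → y ∈ 𝓞 → x * y ∈ 𝔭 → x ∈ 𝔭 ⊎ y ∈ 𝔭
      p∈        : p · 1# ∈ 𝔭

  record IsSubring (O : Pred K 0ℓ) : Set where
    field
      0∈       : 0# ∈ O
      1∈       : 1# ∈ O
      +-closed : ∀ {x y} → x ∈ O → y ∈ O → x + y ∈ O
      *-closed : ∀ {x y} → x ∈ O → y ∈ O → x * y ∈ O
      neg-closed : ∀ {x} → x ∈ O → - x ∈ O

  record IsOrder (O : Pred K 0ℓ) : Set where
    field
      isSubring         : IsSubring O
      finitelyGenerated : ∃ λ n → ∃ λ (g : Vector K n) →
                          (∀ i → g i ∈ O) ×
                          (∀ x → x ∈ O → ∃ λ (z : Vector ℤ n) →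
                             x ≈ sum (λ i → fromℤ rawK (z i) * g i))
      spansOverℚ        : ∀ x → ∃ λ m → NonZero m × m · x ∈ O

  -- The subring generated by ω.
  data ℤ[_] (ω : K) : Pred K 0ℓ where
    gen  : ℤ[ ω ] ω
    0∈   : ℤ[ ω ] 0#
    1∈   : ℤ[ ω ] 1#
    _+∈_ : ∀ {x y} → ℤ[ ω ] x → ℤ[ ω ] y → ℤ[ ω ] (x + y)
    _*∈_ : ∀ {x y} → ℤ[ ω ] x → ℤ[ ω ] y → ℤ[ ω ] (x * y)
    -∈_  : ∀ {x} → ℤ[ ω ] x → ℤ[ ω ] (- x)

SplitsIn : (p d : ℕ) → Set₁
SplitsIn p d = Σ (Pred ℚ[√- d ] 0ℓ) λ 𝔭 → Σ (Pred ℚ[√- d ] 0ℓ) λ 𝔮 →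
  IsPrimeIdealAbove p 𝔭 × IsPrimeIdealAbove p 𝔮 × ¬ (𝔭 ≐ 𝔮)

------------------------------------------------------------------------
-- Quaternion algebras

record Quaternion (a b : ℚ) : Set where
  constructor quat
  field
    t x y z : ℚ

-- The algebra ℚ + ℚi + ℚj + ℚij with i² = a, j² = b and ji = -ij.
Quaternion-rawRing : (a b : ℚ) → RawRing 0ℓ 0ℓ
Quaternion-rawRing a b = record
  { Carrier = Quaternion a b
  ; _≈_     = _≡_
  ; _+_     = λ { (quat t x y z) (quat t′ x′ y′ z′) →
                  quat (t + t′) (x + x′) (y + y′) (z + z′) }
  ; _*_     = λ { (quat t x y z) (quat t′ x′ y′ z′) → quat
                  (t * t′ + a * (x * x′) + b * (y * y′) - a * (b * (z * z′)))
                  (t * x′ + x * t′ + b * (z * y′) - b * (y * z′))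
                  (t * y′ + y * t′ + a * (x * z′) - a * (z * x′))
                  (t * z′ + z * t′ + x * y′ - y * x′) }
  ; -_      = λ { (quat t x y z) → quat (ℚ.- t) (ℚ.- x) (ℚ.- y) (ℚ.- z) }
  ; 0#      = quat 0ℚ 0ℚ 0ℚ 0ℚ
  ; 1#      = quat 1ℚ 0ℚ 0ℚ 0ℚ
  }
  where open import Data.Rational.Base using (_+_; _*_; _-_)

------------------------------------------------------------------------
-- Algebraic closures of 𝔽ₚ

record AlgebraicClosure-𝔽 (p : ℕ) c ℓ : Set (lsuc (c ⊔ ℓ)) where
  field
    commutativeRing : CommutativeRing c ℓ

  open CommutativeRing commutativeRing hiding (zero) public
  open RawMult +-rawMonoid using () renaming (_×_ to _·_)

  field
    _≟_                 : Decidable _≈_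
    1≉0                 : ¬ 1# ≈ 0#
    inverse             : ∀ x → ¬ x ≈ 0# → ∃ λ y → x * y ≈ 1#
    characteristic      : p · 1# ≈ 0#
    algebraicallyClosed : ∀ a as → ∃ λ x → evalMonic rawRing (a ∷ as) x ≈ 0#
    algebraic           : ∀ x → ∃ λ (ns : List ℕ) →
                          evalMonic rawRing (List.map (_· 1#) ns) x ≈ 0#

------------------------------------------------------------------------
-- Elliptic curves

module _ {p : ℕ} (k : AlgebraicClosure-𝔽 p c ℓ) where
  open AlgebraicClosure-𝔽 k
  open RawMult +-rawMonoid using () renaming (_×_ to _·_)
  open RawExp (RawRing.rawSemiring rawRing) using (_^_)
  private
    module CR = CommutativeRing commutativeRing
    module *-CSG = CommutativeSemigroupProperties CR.*-commutativeSemigroup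

  private
    zeroDivisorFree : ∀ {x y} → ¬ x ≈ 0# → ¬ y ≈ 0# → ¬ x * y ≈ 0#
    zeroDivisorFree {x} {y} x≉0 y≉0 xy≈0 =
      let x⁻¹ , xx⁻¹≈1 = inverse x x≉0 in y≉0 (begin
        y              ≈⟨ *-identityˡ y ⟨
        1# * y         ≈⟨ *-congʳ (trans (*-comm x⁻¹ x) xx⁻¹≈1) ⟨
        x⁻¹ * x * y    ≈⟨ *-assoc x⁻¹ x y ⟩
        x⁻¹ * (x * y)  ≈⟨ *-congˡ xy≈0 ⟩
        x⁻¹ * 0#       ≈⟨ zeroʳ x⁻¹ ⟩
        0#             ∎)
      where open SetoidReasoning setoid

    ≉0ˡ : ∀ {x y} → ¬ x * y ≈ 0# → ¬ x ≈ 0#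
    ≉0ˡ xy≉0 x≈0 = xy≉0 (trans (*-congʳ x≈0) (zeroˡ _))

    ≉0ʳ : ∀ {x y} → ¬ x * y ≈ 0# → ¬ y ≈ 0#
    ≉0ʳ xy≉0 y≈0 = xy≉0 (trans (*-congˡ y≈0) (zeroʳ _))

    ≉0-resp : ∀ {x y} → x ≈ y → ¬ x ≈ 0# → ¬ y ≈ 0#
    ≉0-resp x≈y x≉0 y≈0 = x≉0 (trans x≈y y≈0)

  -- Homogeneous coordinates for the projective plane.
  Coordinates : Set c
  Coordinates = Vector Carrier 3

  NonVanishing : Coordinates → Set ℓ
  NonVanishing v = ∃ λ j → ¬ v j ≈ 0#

  infix 4 _∼_

  _∼_ : Coordinates → Coordinates → Set (c ⊔ ℓ)
  v ∼ w = ∃ λ u → ¬ u ≈ 0# × (∀ j → v j ≈ u * w j)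

  private
    ∼-refl : ∀ {v w} → (∀ j → v j ≈ w j) → v ∼ w
    ∼-refl v≈w = 1# , 1≉0 , λ j → trans (v≈w j) (sym (*-identityˡ _))

    ∼-sym : ∀ {v w} → v ∼ w → w ∼ v
    ∼-sym {v} {w} (u , u≉0 , v≈uw) =
      let u⁻¹ , uu⁻¹≈1 = inverse u u≉0 in
      u⁻¹ , ≉0ʳ (≉0-resp (sym uu⁻¹≈1) 1≉0) , λ j → begin
        w j              ≈⟨ *-identityˡ (w j) ⟨
        1# * w j         ≈⟨ *-congʳ (trans (*-comm u⁻¹ u) uu⁻¹≈1) ⟨
        u⁻¹ * u * w j    ≈⟨ *-assoc u⁻¹ u (w j) ⟩
        u⁻¹ * (u * w j)  ≈⟨ *-congˡ (v≈uw j) ⟨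
        u⁻¹ * v j        ∎
      where open SetoidReasoning setoid

    ∼-trans : ∀ {v w x} → v ∼ w → w ∼ x → v ∼ x
    ∼-trans (u , u≉0 , e) (u′ , u′≉0 , e′) =
      u * u′ , zeroDivisorFree u≉0 u′≉0 ,
      λ j → trans (e j) (trans (*-congˡ (e′ j)) (sym (*-assoc u u′ _)))

  -- Multihomogeneous forms on (ℙ²)ʳ, indexed by their multidegree.
  data Form {r : ℕ} : Vec ℕ r → Set c where
    con : Carrier → Form (Vec.replicate r 0)
    var : (i : Fin r) (j : Fin 3) → Form (Vec.replicate r 0 Vec.[ i ]≔ 1)
    _⊕_ : ∀ {δ} → Form δ → Form δ → Form δ
    _⊗_ : ∀ {δ ε} → Form δ → Form ε → Form (Vec.zipWith ℕ._+_ δ ε)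

  eval : ∀ {r} {δ : Vec ℕ r} → Form δ → Vector Coordinates r → Carrier
  eval (con a)   v = a
  eval (var i j) v = v i j
  eval (F ⊕ G)   v = eval F v + eval G v
  eval (F ⊗ G)   v = eval F v * eval G v

  evals : ∀ {r} {δ : Vec ℕ r} → Vector (Form δ) 3 → Vector Coordinates r → Coordinates
  evals F v j = eval (F j) v

  private
    scale : ∀ {r} → Vec ℕ r → Vector Carrier r → Carrier
    scale []      u = 1#
    scale (d ∷ δ) u = u zero ^ d * scale δ (u ∘ suc)

    scale-0 : ∀ r u → scale (Vec.replicate r 0) u ≈ 1#
    scale-0 zero    u = refl
    scale-0 (suc r) u = trans (*-identityˡ _) (scale-0 r (u ∘ suc))

    scale-1 : ∀ {r} (i : Fin r) u → scale (Vec.replicate r 0 Vec.[ i ]≔ 1) u ≈ u i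
    scale-1 {suc r} zero    u =
      trans (*-cong (*-identityʳ _) (scale-0 r (u ∘ suc))) (*-identityʳ _)
    scale-1 {suc r} (suc i) u = trans (*-identityˡ _) (scale-1 i (u ∘ suc))

    scale-+ : ∀ {r} (δ ε : Vec ℕ r) u →
              scale (Vec.zipWith ℕ._+_ δ ε) u ≈ scale δ u * scale ε u
    scale-+ []      []      u = sym (*-identityˡ 1#)
    scale-+ (d ∷ δ) (e ∷ ε) u =
      trans (*-cong (Exp.^-homo-* CR.semiring (u zero) d e) (scale-+ δ ε (u ∘ suc)))
            (*-CSG.interchange _ _ _ _)

    ^≉0 : ∀ {x} n → ¬ x ≈ 0# → ¬ x ^ n ≈ 0#
    ^≉0 zero    x≉0 = 1≉0
    ^≉0 (suc n) x≉0 = zeroDivisorFree x≉0 (^≉0 n x≉0)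

    scale≉0 : ∀ {r} (δ : Vec ℕ r) {u} → (∀ i → ¬ u i ≈ 0#) → ¬ scale δ u ≈ 0#
    scale≉0 []      u≉0 = 1≉0
    scale≉0 (d ∷ δ) u≉0 = zeroDivisorFree (^≉0 d (u≉0 zero)) (scale≉0 δ (u≉0 ∘ suc))

    eval-scale : ∀ {r} {δ : Vec ℕ r} (F : Form δ) {v w u} →
                 (∀ i j → v i j ≈ u i * w i j) → eval F v ≈ scale δ u * eval F w
    eval-scale {r} (con a) {u = u} e = sym (trans (*-congʳ (scale-0 r u)) (*-identityˡ a))
    eval-scale (var i j) e = trans (e i j) (*-congʳ (sym (scale-1 i _)))
    eval-scale (F ⊕ G)   e =
      trans (+-cong (eval-scale F e) (eval-scale G e)) (sym (distribˡ _ _ _))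
    eval-scale (_⊗_ {δ} {ε} F G) e =
      trans (*-cong (eval-scale F e) (eval-scale G e))
      (trans (*-CSG.interchange _ _ _ _) (*-congʳ (sym (scale-+ δ ε _))))

    evals-∼ : ∀ {r} {δ : Vec ℕ r} (F : Vector (Form δ) 3) {v w : Vector Coordinates r} →
              (∀ i → v i ∼ w i) → evals F v ∼ evals F w
    evals-∼ {δ = δ} F v∼w =
      scale δ (proj₁ ∘ v∼w) , scale≉0 δ (proj₁ ∘ proj₂ ∘ v∼w) ,
      λ j → eval-scale (F j) (λ i → proj₂ (proj₂ (v∼w i)))

    -- Substitution of forms in one point for the variables of F.
    degree : ∀ {r} → Vec ℕ r → Vector ℕ r → ℕ
    degree []      e = 0
    degree (d ∷ δ) e = d ℕ.* e zero ℕ.+ degree δ (e ∘ suc)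

    degree-0 : ∀ r e → degree (Vec.replicate r 0) e ≡ 0
    degree-0 zero    e = ≡.refl
    degree-0 (suc r) e = degree-0 r (e ∘ suc)

    degree-1 : ∀ {r} (i : Fin r) e → degree (Vec.replicate r 0 Vec.[ i ]≔ 1) e ≡ e i
    degree-1 {suc r} zero    e = ≡.trans (≡.cong₂ ℕ._+_ (ℕₚ.*-identityˡ _) (degree-0 r _))
                                         (ℕₚ.+-identityʳ _)
    degree-1 {suc r} (suc i) e = degree-1 i (e ∘ suc)

    degree-+ : ∀ {r} (δ ε : Vec ℕ r) e →
               degree (Vec.zipWith ℕ._+_ δ ε) e ≡ degree δ e ℕ.+ degree ε e
    degree-+ []      []      e = ≡.refl
    degree-+ (m ∷ δ) (n ∷ ε) e =
      ≡.trans (≡.cong₂ ℕ._+_ (ℕₚ.*-distribʳ-+ (e zero) m n) (degree-+ δ ε (e ∘ suc)))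
              (ℕ-interchange (m ℕ.* e zero) (n ℕ.* e zero) _ _)
      where
      open CommutativeSemigroupProperties ℕₚ.+-commutativeSemigroup
        using () renaming (interchange to ℕ-interchange)

    FormLike : ℕ → (Coordinates → Carrier) → Set (c ⊔ ℓ)
    FormLike n f = Σ (Form (n ∷ [])) λ H → ∀ v → eval H (λ _ → v) ≈ f v

    substitute : ∀ {r} {δ : Vec ℕ r} (F : Form δ) {e : Vector ℕ r} →
                 (G : ∀ i → Vector (Form (e i ∷ [])) 3) →
                 FormLike (degree δ e) (λ v → eval F (λ i → evals (G i) (λ _ → v)))
    substitute {r} (con a) {e} G =
      ≡.subst (λ n → FormLike n (λ _ → a)) (≡.sym (degree-0 r e)) (con a , λ _ → refl)
    substitute (var i j) {e} G =
      ≡.subst (λ n → FormLike n (λ v → eval (G i j) (λ _ → v))) (≡.sym (degree-1 i e))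
        (G i j , λ _ → refl)
    substitute (F ⊕ F′) G =
      let H , e = substitute F G ; H′ , e′ = substitute F′ G in
      H ⊕ H′ , λ v → +-cong (e v) (e′ v)
    substitute (_⊗_ {δ} {ε} F F′) {d} G =
      let H , e = substitute F G ; H′ , e′ = substitute F′ G in
      ≡.subst (λ n → FormLike n (λ v → eval F (λ i → evals (G i) (λ _ → v))
                                     * eval F′ (λ i → evals (G i) (λ _ → v))))
        (≡.sym (degree-+ δ ε d)) (H ⊗ H′ , λ v → *-cong (e v) (e′ v))

    product : ∀ {r} {e : Vector ℕ r} (G : ∀ i → Form (e i ∷ [])) →
              Σ ℕ λ n → Σ (Form (n ∷ [])) λ H → ∀ v →
              (eval H v ≈ 0# → ¬ (∀ i → ¬ eval (G i) v ≈ 0#)) ×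
              (¬ eval H v ≈ 0# → ∀ i → ¬ eval (G i) v ≈ 0#)
    product {zero}  G = 0 , con 1# , λ v → (λ 1≈0 _ → 1≉0 1≈0) , λ _ ()
    product {suc r} G =
      let n , H , h = product (G ∘ suc) in
      _ , G zero ⊗ H , λ v →
        (λ GH≈0 G≉0 → zeroDivisorFree (G≉0 zero)
                        (λ H≈0 → proj₁ (h v) H≈0 (G≉0 ∘ suc)) GH≈0) ,
        λ GH≉0 → λ { zero → ≉0ˡ GH≉0 ; (suc i) → proj₂ (h v) (≉0ʳ GH≉0) i }

  record Weierstrass : Set c where
    field
      a₁ a₂ a₃ a₄ a₆ : Carrier

    b₂ b₄ b₆ b₈ Δ : Carrier
    b₂ = a₁ ^ 2 + 4 · a₂
    b₄ = 2 · a₄ + a₁ * a₃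
    b₆ = a₃ ^ 2 + 4 · a₆
    b₈ = a₁ ^ 2 * a₆ + 4 · (a₂ * a₆) - a₁ * a₃ * a₄ + a₂ * a₃ ^ 2 - a₄ ^ 2
    Δ  = - (b₂ ^ 2 * b₈) - 8 · (b₄ ^ 3) - 27 · (b₆ ^ 2) + 9 · (b₂ * b₄ * b₆)

    OnCurve : Coordinates → Set ℓ
    OnCurve v =
      Y ^ 2 * Z + a₁ * X * Y * Z + a₃ * Y * Z ^ 2 ≈
      X ^ 3 + a₂ * X ^ 2 * Z + a₄ * X * Z ^ 2 + a₆ * Z ^ 3
      where
      X = v zero
      Y = v (suc zero)
      Z = v (suc (suc zero))

    record Point : Set (c ⊔ ℓ) where
      field
        coords       : Coordinates
        nonVanishing : NonVanishing coords
        onCurve      : OnCurve coords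

    open Point public

    infix 4 _≈ₚ_

    -- A record rather than a synonym, so that P and Q can be inferred.
    record _≈ₚ_ (P Q : Point) : Set (c ⊔ ℓ) where
      constructor proportional
      field
        coords-∼ : coords P ∼ coords Q

    -- The point at infinity [0 : 1 : 0].
    O : Point
    O = record
      { coords       = λ { zero → 0# ; (suc zero) → 1# ; (suc (suc zero)) → 0# }
      ; nonVanishing = suc zero , 1≉0
      ; onCurve      =
          trans (+-cong (+-cong (zeroʳ _) (zeroʳ _)) (trans (*-congˡ (zeroˡ _)) (zeroʳ _)))
          (trans (trans (+-identityʳ _) (+-identityʳ _)) (sym
          (trans (+-cong (+-cong (+-cong (zeroˡ _) (zeroʳ _))
                                 (trans (*-congˡ (zeroˡ _)) (zeroʳ _)))
                         (trans (*-congˡ (zeroˡ _)) (zeroʳ _)))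
          (trans (+-identityʳ _) (trans (+-identityʳ _) (+-identityʳ _))))))
      }

    -- A map Eʳ → E is regular if around every point of Eʳ it is given by
    -- three multihomogeneous forms of the same multidegree.
    record Regular {r : ℕ} (f : Vector Point r → Point) : Set (c ⊔ ℓ) where
      constructor mkRegular
      field
        local : ∀ P → Σ (Vec ℕ r) λ δ → Σ (Vector (Form δ) 3) λ F →
          NonVanishing (evals F (coords ∘ P)) ×
          (∀ Q → NonVanishing (evals F (coords ∘ Q)) →
                 coords (f Q) ∼ evals F (coords ∘ Q))

    open Regular

    Regular₁ : (Point → Point) → Set (c ⊔ ℓ)
    Regular₁ f = Regular {1} (λ P → f (P zero))

    Regular₂ : (Point → Point → Point) → Set (c ⊔ ℓ)
    Regular₂ f = Regular {2} (λ P → f (P zero) (P (suc zero)))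

    private
      Local : (Point → Point) → Point → ℕ → Set (c ⊔ ℓ)
      Local f P n = Σ (Vector (Form (n ∷ [])) 3) λ F →
        NonVanishing (evals F (λ _ → coords P)) ×
        (∀ Q → NonVanishing (evals F (λ _ → coords Q)) →
               coords (f Q) ∼ evals F (λ _ → coords Q))

      localise : ∀ f → Regular₁ f → ∀ P → ∃ (Local f P)
      localise f reg P with local reg (λ _ → P)
      ... | (n ∷ []) , F , nz , rep = n , F , nz , λ Q → rep (λ _ → Q)

      globalise : ∀ f → (∀ P → ∃ (Local f P)) → Regular₁ f
      globalise f loc = mkRegular λ P →
        let n , F , (j , nz) , rep = loc (P zero)
        in n ∷ [] , F , (j , ≉0-resp (η F j P) nz) , λ { Q (i , nzQ) →
             let u , u≉0 , e = rep (Q zero) (i , ≉0-resp (sym (η F i Q)) nzQ)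
             in u , u≉0 , λ l → trans (e l) (*-congˡ (η F l Q)) }
        where
        η : ∀ {n} (F : Vector (Form (n ∷ [])) 3) j (Q : Vector Point 1) →
            eval (F j) (λ _ → coords (Q zero)) ≈ eval (F j) (coords ∘ Q)
        η {n} F j Q = trans (eval-scale (F j) {u = λ _ → 1#}
                           (λ { zero l → sym (*-identityˡ _) }))
                        (trans (*-congʳ (scale≈1 n)) (*-identityˡ _))
          where
          1^ : ∀ n → 1# ^ n ≈ 1#
          1^ zero    = refl
          1^ (suc n) = trans (*-identityˡ _) (1^ n)
          scale≈1 : ∀ m → scale (m ∷ []) (λ _ → 1#) ≈ 1#
          scale≈1 m = trans (*-identityʳ _) (1^ m)

    id-regular : Regular₁ id
    id-regular = globalise id λ P → 1 , var zero , nonVanishing P , λ Q _ → ∼-refl (λ _ → refl)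

    const-regular : ∀ P → Regular₁ (λ _ → P)
    const-regular P = globalise (λ _ → P) λ _ → 0 , con ∘ coords P , nonVanishing P ,
                                      λ _ _ → ∼-refl (λ _ → refl)

    ∘-regular : ∀ {r} {f : Vector Point r → Point} {g : Vector (Point → Point) r} →
                Regular f → (∀ i → Regular₁ (g i)) → Regular₁ (λ P → f (λ i → g i P))
    ∘-regular {r} {f} {g} f-reg g-reg = globalise (λ P → f (λ i → g i P)) composite
      where
      composite : ∀ P → ∃ (Local (λ P → f (λ i → g i P)) P)
      composite P =
        _ , (λ j → D ⊗ proj₁ (H j)) , (j₀ , DH≉0) , λ Q (j , nz) →
          let GQ≉0 = proj₂ (proj₂ (proj₂ Dprod) (λ _ → coords Q)) (≉0ˡ nz)
              gQ∼GQ = λ i → proj₂ (proj₂ (proj₂ (loc i))) Q (index i , GQ≉0 i)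
              u , u≉0 , e = evals-∼ F gQ∼GQ
              FgQ≉0 = ≉0-resp (sym (e j))
                        (zeroDivisorFree u≉0 (≉0-resp (proj₂ (H j) (coords Q)) (≉0ʳ nz)))
          in ∼-trans (frep (λ i → g i Q) (j , FgQ≉0))
             (∼-trans (u , u≉0 , e)
             (∼-sym (eval D (λ _ → coords Q) , ≉0ˡ nz ,
                     λ l → *-congˡ (proj₂ (H l) (coords Q)))))
        where
        loc   = λ i → localise (g i) (g-reg i) P
        G     = λ i → proj₁ (proj₂ (loc i))
        index : Vector (Fin 3) r
        index = λ i → proj₁ (proj₁ (proj₂ (proj₂ (loc i))))
        fP    = local f-reg (λ i → g i P)
        F     = proj₁ (proj₂ fP)
        j₀    = proj₁ (proj₁ (proj₂ (proj₂ fP)))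
        frep  = proj₂ (proj₂ (proj₂ fP))
        H     = λ j → substitute (F j) G
        -- The factor D cuts out the locus where each G i represents g i.
        Dprod = product (λ i → G i (index i))
        D     = proj₁ (proj₂ Dprod)
        gP∼GP : ∀ i → coords (g i P) ∼ evals (G i) (λ _ → coords P)
        gP∼GP i = proj₂ (proj₂ (proj₂ (loc i))) P (proj₁ (proj₂ (proj₂ (loc i))))
        DH≉0 : ¬ eval (D ⊗ proj₁ (H j₀)) (λ _ → coords P) ≈ 0#
        DH≉0 = zeroDivisorFree
          (λ D≈0 → proj₁ (proj₂ (proj₂ Dprod) (λ _ → coords P)) D≈0
                     (λ i → proj₂ (proj₁ (proj₂ (proj₂ (loc i))))))
          (≉0-resp (sym (proj₂ (H j₀) (coords P)))
            (≉0ʳ (≉0-resp (proj₂ (proj₂ (evals-∼ F gP∼GP)) j₀)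
                          (proj₂ (proj₁ (proj₂ (proj₂ fP)))))))

  -- A nonsingular Weierstrass cubic with its structure of algebraic group
  -- with identity O.  By rigidity there is at most one such structure, so
  -- the group fields name the chord-and-tangent law, not extra data.
  record EllipticCurve : Set (lsuc (c ⊔ ℓ)) where
    field
      weierstrass : Weierstrass

    open Weierstrass weierstrass public

    infixl 6 _+ₚ_

    field
      nonsingular    : ¬ Δ ≈ 0#
      _+ₚ_           : Point → Point → Point
      -ₚ_            : Point → Point
      isAbelianGroup : IsAbelianGroup _≈ₚ_ _+ₚ_ O -ₚ_
      +ₚ-regular     : Regular₂ _+ₚ_
      -ₚ-regular     : Regular₁ -ₚ_

    abelianGroup : AbelianGroup (c ⊔ ℓ) (c ⊔ ℓ)
    abelianGroup = record { isAbelianGroup = isAbelianGroup }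

  module _ (E : EllipticCurve) where
    open EllipticCurve E
    private
      module A = AbelianGroup abelianGroup
      module Aₚ = AbelianGroupProperties abelianGroup
      open GroupMorphisms A.rawGroup A.rawGroup using (IsGroupHomomorphism)
      open CommutativeSemigroupProperties A.commutativeSemigroup using (interchange)

    -- k is algebraically closed, so these are the geometric endomorphisms.
    record Endomorphism : Set (c ⊔ ℓ) where
      field
        ⟦_⟧                 : Point → Point
        isGroupHomomorphism : IsGroupHomomorphism ⟦_⟧
        regular             : Regular₁ ⟦_⟧

      open GroupMorphisms.IsGroupHomomorphism isGroupHomomorphism public
        using (⟦⟧-cong; homo; ε-homo; ⁻¹-homo)

    open Endomorphism

    private
      mkHomomorphism : ∀ {f} → f Preserves _≈ₚ_ ⟶ _≈ₚ_ →
                       (∀ P Q → f (P +ₚ Q) ≈ₚ f P +ₚ f Q) → f O ≈ₚ O →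
                       (∀ P → f (-ₚ P) ≈ₚ -ₚ (f P)) → IsGroupHomomorphism f
      mkHomomorphism f-cong f-homo f-ε f-⁻¹ = record
        { isMonoidHomomorphism = record
          { isMagmaHomomorphism = record
            { isRelHomomorphism = record { cong = f-cong }
            ; homo              = f-homo
            }
          ; ε-homo = f-ε
          }
        ; ⁻¹-homo = f-⁻¹
        }

    0ᴱ 1ᴱ : Endomorphism
    0ᴱ = record
      { ⟦_⟧                 = λ _ → O
      ; isGroupHomomorphism = mkHomomorphism (λ _ → A.refl)
          (λ _ _ → A.sym (A.identityˡ O)) A.refl (λ _ → A.sym Aₚ.ε⁻¹≈ε)
      ; regular             = const-regular O
      }
    1ᴱ = record
      { ⟦_⟧                 = id
      ; isGroupHomomorphism = Identity.isGroupHomomorphism A.rawGroup A.refl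
      ; regular             = id-regular
      }

    _+ᴱ_ _∘ᴱ_ : Endomorphism → Endomorphism → Endomorphism
    φ +ᴱ ψ = record
      { ⟦_⟧                 = λ P → ⟦ φ ⟧ P +ₚ ⟦ ψ ⟧ P
      ; isGroupHomomorphism = mkHomomorphism
          (λ P≈Q → A.∙-cong (⟦⟧-cong φ P≈Q) (⟦⟧-cong ψ P≈Q))
          (λ P Q → A.trans (A.∙-cong (homo φ P Q) (homo ψ P Q)) (interchange _ _ _ _))
          (A.trans (A.∙-cong (ε-homo φ) (ε-homo ψ)) (A.identityˡ O))
          (λ P → A.trans (A.∙-cong (⁻¹-homo φ P) (⁻¹-homo ψ P)) (Aₚ.⁻¹-∙-comm _ _))
      ; regular             = ∘-regular
          {g = λ { zero → ⟦ φ ⟧ ; (suc _) → ⟦ ψ ⟧ }} +ₚ-regular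
          (λ { zero → regular φ ; (suc zero) → regular ψ })
      }
    φ ∘ᴱ ψ = record
      { ⟦_⟧                 = ⟦ φ ⟧ ∘ ⟦ ψ ⟧
      ; isGroupHomomorphism = Compose.isGroupHomomorphism A.trans
          (isGroupHomomorphism ψ) (isGroupHomomorphism φ)
      ; regular             = ∘-regular {g = λ _ → ⟦ ψ ⟧} (regular φ) (λ _ → regular ψ)
      }

    -ᴱ_ : Endomorphism → Endomorphism
    -ᴱ φ = record
      { ⟦_⟧                 = λ P → -ₚ (⟦ φ ⟧ P)
      ; isGroupHomomorphism = mkHomomorphism
          (λ P≈Q → A.⁻¹-cong (⟦⟧-cong φ P≈Q))
          (λ P Q → A.trans (A.⁻¹-cong (homo φ P Q)) (A.sym (Aₚ.⁻¹-∙-comm _ _)))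
          (A.trans (A.⁻¹-cong (ε-homo φ)) Aₚ.ε⁻¹≈ε)
          (λ P → A.⁻¹-cong (⁻¹-homo φ P))
      ; regular             = ∘-regular {g = λ _ → ⟦ φ ⟧} -ₚ-regular (λ _ → regular φ)
      }

    End : Ring (c ⊔ ℓ) (c ⊔ ℓ)
    End = record
      { Carrier = Endomorphism
      ; _≈_     = λ φ ψ → ∀ P → ⟦ φ ⟧ P ≈ₚ ⟦ ψ ⟧ P
      ; _+_     = _+ᴱ_
      ; _*_     = _∘ᴱ_
      ; -_      = -ᴱ_
      ; 0#      = 0ᴱ
      ; 1#      = 1ᴱ
      ; isRing  = record
        { +-isAbelianGroup = record
          { isGroup = record
            { isMonoid = record
              { isSemigroup = record
                { isMagma = record
                  { isEquivalence = record
                    { refl  = λ _ → A.refl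
                    ; sym   = λ e P → A.sym (e P)
                    ; trans = λ e e′ P → A.trans (e P) (e′ P)
                    }
                  ; ∙-cong = λ e e′ P → A.∙-cong (e P) (e′ P)
                  }
                ; assoc = λ φ ψ χ P → A.assoc _ _ _
                }
              ; identity = (λ φ P → A.identityˡ _) , (λ φ P → A.identityʳ _)
              }
            ; inverse = (λ φ P → A.inverseˡ _) , (λ φ P → A.inverseʳ _)
            ; ⁻¹-cong = λ e P → A.⁻¹-cong (e P)
            }
          ; comm = λ φ ψ P → A.comm _ _
          }
        ; *-cong     = λ {φ} {φ′} {ψ} {ψ′} e e′ P → A.trans (⟦⟧-cong φ (e′ P)) (e _)
        ; *-assoc    = λ φ ψ χ P → A.refl
        ; *-identity = (λ φ P → A.refl) , (λ φ P → A.refl)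
        ; distrib    = (λ φ ψ χ P → homo φ _ _) , (λ φ ψ χ P → A.refl)
        }
      }

    -- Supersingularity in its endomorphism-ring form: End(E) is an order in a
    -- definite quaternion algebra over ℚ.
    Supersingular : Set (c ⊔ ℓ)
    Supersingular =
      ∃ λ a → ∃ λ b → a ℚ.< 0ℚ × b ℚ.< 0ℚ ×
      ∃ λ f → RingMorphisms.IsRingIsomorphism (Quaternion-rawRing a b) (End ⊗ℚ) f

    toEnd⊗ℚ : Endomorphism → RawRing.Carrier (End ⊗ℚ)
    toEnd⊗ℚ α = α / 1

    record Orientation (d : ℕ) : Set (c ⊔ ℓ) where
      field
        ι                  : ℚ[√- d ] → RawRing.Carrier (End ⊗ℚ)
        isRingMonomorphism :
          RingMorphisms.IsRingMonomorphism ℚ[√- d ]-rawRing (End ⊗ℚ) ι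

    module _ {d : ℕ} (o : Orientation d) where
      open Orientation o
      open RawRing (End ⊗ℚ) using () renaming (_≈_ to _≈ℚ_; _*_ to _*ℚ_)

      Primitive : Pred ℚ[√- d ] 0ℓ → Set (c ⊔ ℓ)
      Primitive 𝒪 = ∀ θ →
        ((∃ λ x → ι x ≈ℚ θ) × (∃ λ φ → toEnd⊗ℚ φ ≈ℚ θ)) ⇔
        (∃ λ x → x ∈ 𝒪 × ι x ≈ℚ θ)

      ι̂ : ℚ[√- d ] → RawRing.Carrier (End ⊗ℚ)
      ι̂ x = ι (conj x)

      -- End(E) is torsion-free, so the equation may be read in End(E) ⊗ ℚ,
      -- where ι takes its values.  The zero endomorphism always satisfies it.
      IsTwisting : ℚ[√- d ] → Endomorphism → Set (c ⊔ ℓ)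
      IsTwisting ω α = (ι̂ ω *ℚ toEnd⊗ℚ α) ≈ℚ (toEnd⊗ℚ α *ℚ ι ω)

{-# OPTIONS --safe #-}

-- Through the isomorphism End(E) ⊗ ℚ ≅ H with a definite quaternion algebra,
-- ι becomes a ring homomorphism g : ℚ(√-d) → H.  Restricted to ℚ it is
-- additive in every coordinate, so g(u) = u; and g(√-d), having a negative
-- rational square, is a pure quaternion xi + yj + zij.  A nonzero pure
-- quaternion β orthogonal to g(√-d) anticommutes with it, which gives
-- g(ω̄)β = βg(ω); clearing the denominator of β yields the endomorphism.
module Submission where

open import Defs
open import Level using (Level)
open import Algebra.Bundles using (Ring; RawRing)
open import Algebra.Morphism.Structures using (module RingMorphisms)
import Algebra.Definitions.RawMonoid as RawMult
import Algebra.Properties.CommutativeMonoid.Mult as CommutativeMonoidMult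
import Algebra.Properties.Group as GroupProperties
import Algebra.Properties.Semiring.Mult as SemiringMult
open import Data.Integer.Base as ℤ using (ℤ; -[1+_])
import Data.Integer.Properties as ℤₚ
open import Data.Nat.Base as ℕ using (ℕ; zero; suc; _<_; NonZero)
import Data.Nat.Properties as ℕₚ
open import Data.Nat.Primality using (Prime)
open import Data.Nat.Solver using (module +-*-Solver)
open import Data.Product.Base using (∃; _×_; _,_; proj₁; proj₂)
open import Data.Rational.Base as ℚ using (ℚ; 0ℚ; 1ℚ; toℚᵘ; ↥_; ↧_)
import Data.Rational.Properties as ℚₚ
open import Data.Rational.Solver using () renaming (module +-*-Solver to ℚ-Solver)
open import Data.Rational.Unnormalised.Base as ℚᵘ using (mkℚᵘ; *≡*)
import Data.Rational.Unnormalised.Properties as ℚᵘₚ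
open import Function.Base using (_∘_)
open import Relation.Binary.Bundles using (Setoid)
open import Relation.Binary.Definitions using (tri<; tri≈; tri>)
open import Relation.Binary.PropositionalEquality
  using (_≡_; _≢_; refl; sym; trans; cong; cong₂; module ≡-Reasoning)
import Relation.Binary.Reasoning.Setoid as SetoidReasoning
open import Relation.Nullary.Decidable using (yes; no)
open import Relation.Nullary.Negation using (¬_; contradiction)

private
  variable
    c ℓ : Level

-- Fractions of a ring

module _ (R : Ring c ℓ) where
  open Ring R using (Carrier; _≈_; _+_; _*_; +-cong; *-cong)
    renaming (refl to ≈-refl; sym to ≈-sym; trans to ≈-trans)
  open RawMult (Ring.+-rawMonoid R) using () renaming (_×_ to _·_)
  open SemiringMult (Ring.semiring R) using (×-assocˡ; ×-congˡ; ×-congʳ; ×-comm-*; ×-assoc-*)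
  open CommutativeMonoidMult (Ring.+-commutativeMonoid R) using (×-distrib-+)
  open RawRing (R ⊗ℚ) using () renaming (_≈_ to _≈ℚ_; _+_ to _+ℚ_; _*_ to _*ℚ_)
  open SetoidReasoning (Ring.setoid R)
  open +-*-Solver

  private
    ·-assoc₃ : ∀ i j k x → i · (j · (k · x)) ≈ (i ℕ.* (j ℕ.* k)) · x
    ·-assoc₃ i j k x = ≈-trans (×-congʳ i (×-assocˡ x j k)) (×-assocˡ x i (j ℕ.* k))

    -- An equality of fractions arrives as nested multiples. Merging them into one natural
    -- coefficient per side reduces the later congruences to identities in ℕ, which the solver
    -- closes.
    ·-scale : ∀ n i {j k x y} → i · (j · x) ≈ i · (k · y) →
              (n ℕ.* (i ℕ.* j)) · x ≈ (n ℕ.* (i ℕ.* k)) · y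
    ·-scale n i {j} {k} e =
      ≈-trans (≈-sym (·-assoc₃ n i j _)) (≈-trans (×-congʳ n e) (·-assoc₃ n i k _))

    ·-combination : ∀ i j k l x y → i · (j · (k · x + l · y)) ≈
                    (i ℕ.* (j ℕ.* k)) · x + (i ℕ.* (j ℕ.* l)) · y
    ·-combination i j k l x y = begin
      i · (j · (k · x + l · y))              ≈⟨ ×-congʳ i (×-distrib-+ _ _ j) ⟩
      i · (j · (k · x) + j · (l · y))        ≈⟨ ×-distrib-+ _ _ i ⟩
      i · (j · (k · x)) + i · (j · (l · y))  ≈⟨ +-cong (·-assoc₃ i j k x) (·-assoc₃ i j l y) ⟩
      (i ℕ.* (j ℕ.* k)) · x + (i ℕ.* (j ℕ.* l)) · y  ∎

    ·-*-interchange : ∀ m n x y → (m ℕ.* n) · (x * y) ≈ (m · x) * (n · y)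
    ·-*-interchange m n x y = begin
      (m ℕ.* n) · (x * y)  ≈⟨ ×-assocˡ (x * y) m n ⟨
      m · (n · (x * y))    ≈⟨ ×-congʳ m (×-comm-* n x y) ⟨
      m · (x * (n · y))    ≈⟨ ×-assoc-* m x (n · y) ⟨
      (m · x) * (n · y)    ∎

  infix 4 _≃_

  -- A record rather than the bare equality, so that both sides can be inferred.
  record _≃_ (x y : Fraction Carrier) : Set ℓ where
    constructor equal
    field
      equality : x ≈ℚ y

  open _≃_ public

  ⊗ℚ-refl : ∀ {x} → x ≃ x
  ⊗ℚ-refl = equal (1 , _ , ≈-refl)

  ⊗ℚ-sym : ∀ {x y} → x ≃ y → y ≃ x
  ⊗ℚ-sym (equal (t , t≢0 , e)) = equal (t , t≢0 , ≈-sym e)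

  -- The middle denominator `m` cannot be cancelled, because `R` may have torsion, so it is absorbed
  -- into the witness `s t m`. The first equation is scaled by `t n`, the second by `s l`.
  ⊗ℚ-trans : ∀ {x y z} → x ≃ y → y ≃ z → x ≃ z
  ⊗ℚ-trans {a / l} {b / m} {x / n} (equal (s , s≢0 , e)) (equal (t , t≢0 , e′)) = equal (
    s ℕ.* (t ℕ.* m) ,
    ℕₚ.m*n≢0 s (t ℕ.* m) {{s≢0}} {{ℕₚ.m*n≢0 t m {{t≢0}}}} ,
    (begin
      (s ℕ.* (t ℕ.* m)) · (n · a)     ≈⟨ ×-assocˡ a (s ℕ.* (t ℕ.* m)) n ⟩
      (s ℕ.* (t ℕ.* m) ℕ.* n) · a     ≈⟨ ×-congˡ (solve 4 (λ s t m n →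
                                           s :* (t :* m) :* n := t :* n :* (s :* m)) refl s t m n) ⟩
      (t ℕ.* n ℕ.* (s ℕ.* m)) · a     ≈⟨ ·-scale (t ℕ.* n) s e ⟩
      (t ℕ.* n ℕ.* (s ℕ.* l)) · b     ≈⟨ ×-congˡ (ℕₚ.*-comm (t ℕ.* n) (s ℕ.* l)) ⟩
      (s ℕ.* l ℕ.* (t ℕ.* n)) · b     ≈⟨ ·-scale (s ℕ.* l) t e′ ⟩
      (s ℕ.* l ℕ.* (t ℕ.* m)) · x     ≈⟨ ×-congˡ (solve 4 (λ s t m l →
                                           s :* l :* (t :* m) := s :* (t :* m) :* l) refl s t m l) ⟩
      (s ℕ.* (t ℕ.* m) ℕ.* l) · x     ≈⟨ ×-assocˡ x (s ℕ.* (t ℕ.* m)) l ⟨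
      (s ℕ.* (t ℕ.* m)) · (l · x)     ∎))

  ⊗ℚ-setoid : Setoid _ _
  ⊗ℚ-setoid = record
    { _≈_           = _≃_
    ; isEquivalence = record { refl = ⊗ℚ-refl ; sym = ⊗ℚ-sym ; trans = ⊗ℚ-trans }
    }

  -- After expanding both numerators the two summands are compared separately: `first` is `e` scaled
  -- by `t n n′`, and `second` is `e′` scaled by `s m m′`.
  ⊗ℚ-+-cong : ∀ {w x y z} → w ≃ x → y ≃ z → w +ℚ y ≃ x +ℚ z
  ⊗ℚ-+-cong {a / m} {a′ / m′} {b / n} {b′ / n′} (equal (s , s≢0 , e)) (equal (t , t≢0 , e′)) = equal (
    s ℕ.* t , ℕₚ.m*n≢0 s t {{s≢0}} {{t≢0}} ,
    ≈-trans (·-combination (s ℕ.* t) (m′ ℕ.* n′) n m a b)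
    (≈-trans (+-cong first second)
      (≈-sym (·-combination (s ℕ.* t) (m ℕ.* n) n′ m′ a′ b′))))
    where
    first : (s ℕ.* t ℕ.* (m′ ℕ.* n′ ℕ.* n)) · a ≈ (s ℕ.* t ℕ.* (m ℕ.* n ℕ.* n′)) · a′
    first = begin
      _  ≈⟨ ×-congˡ (solve 5 (λ s t m′ n n′ →
              s :* t :* (m′ :* n′ :* n) := t :* n :* n′ :* (s :* m′)) refl s t m′ n n′) ⟩
      _  ≈⟨ ·-scale (t ℕ.* n ℕ.* n′) s e ⟩
      _  ≈⟨ ×-congˡ (solve 5 (λ s t m n n′ →
              t :* n :* n′ :* (s :* m) := s :* t :* (m :* n :* n′)) refl s t m n n′) ⟩
      _  ∎

    second : (s ℕ.* t ℕ.* (m′ ℕ.* n′ ℕ.* m)) · b ≈ (s ℕ.* t ℕ.* (m ℕ.* n ℕ.* m′)) · b′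
    second = begin
      _  ≈⟨ ×-congˡ (solve 5 (λ s t m m′ n′ →
              s :* t :* (m′ :* n′ :* m) := s :* m :* m′ :* (t :* n′)) refl s t m m′ n′) ⟩
      _  ≈⟨ ·-scale (s ℕ.* m ℕ.* m′) t e′ ⟩
      _  ≈⟨ ×-congˡ (solve 5 (λ s t m m′ n →
              s :* m :* m′ :* (t :* n) := s :* t :* (m :* n :* m′)) refl s t m m′ n) ⟩
      _  ∎

  -- Natural multiples are central in `R`, so the two given equations can be multiplied side by
  -- side, and their witnesses multiply as well.
  ⊗ℚ-*-cong : ∀ {w x y z} → w ≃ x → y ≃ z → w *ℚ y ≃ x *ℚ z
  ⊗ℚ-*-cong {a / m} {a′ / m′} {b / n} {b′ / n′} (equal (s , s≢0 , e)) (equal (t , t≢0 , e′)) = equal (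
    s ℕ.* t , ℕₚ.m*n≢0 s t {{s≢0}} {{t≢0}} , (begin
      (s ℕ.* t) · ((m′ ℕ.* n′) · (a * b))  ≈⟨ ×-congʳ (s ℕ.* t) (·-*-interchange m′ n′ a b) ⟩
      (s ℕ.* t) · ((m′ · a) * (n′ · b))    ≈⟨ ·-*-interchange s t _ _ ⟩
      (s · (m′ · a)) * (t · (n′ · b))      ≈⟨ *-cong e e′ ⟩
      (s · (m · a′)) * (t · (n · b′))      ≈⟨ ·-*-interchange s t _ _ ⟨
      (s ℕ.* t) · ((m · a′) * (n · b′))    ≈⟨ ×-congʳ (s ℕ.* t) (·-*-interchange m n a′ b′) ⟨
      (s ℕ.* t) · ((m ℕ.* n) · (a′ * b′))  ∎))

  -- Used in contrapositive form: replacing a nonzero fraction by its numerator cannot produce zero.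
  num≈0⇒≈0 : ∀ q → Fraction.num q ≈ Ring.0# R → q ≃ RawRing.0# (R ⊗ℚ)
  num≈0⇒≈0 (a / n) a≈0 = equal (1 , _ , ×-congʳ 1 (begin
    1 · a           ≈⟨ ×-congʳ 1 a≈0 ⟩
    1 · Ring.0# R   ≈⟨ Ring.+-identityʳ R _ ⟩
    Ring.0# R       ≈⟨ ·-zero n ⟨
    n · Ring.0# R   ∎))
    where
    ·-zero : ∀ n → n · Ring.0# R ≈ Ring.0# R
    ·-zero zero    = ≈-refl
    ·-zero (suc n) = ≈-trans (Ring.+-identityˡ R _) (·-zero n)

  -- The denominator `m` of `q` occurs exactly once in the denominator of each side, so it can be
  -- moved into the witness, which becomes `t m`.
  clear-denominator : ∀ {x y} q → let a = Fraction.num q in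
                      x *ℚ q ≃ q *ℚ y → x *ℚ (a / 1) ≃ (a / 1) *ℚ y
  clear-denominator {ξ / k} {η / l} (a / m) (equal (t , t≢0 , e)) = equal (
    t ℕ.* m , ℕₚ.m*n≢0 t m {{t≢0}} , (begin
      (t ℕ.* m) · ((1 ℕ.* l) · (ξ * a))    ≈⟨ ×-assocˡ _ (t ℕ.* m) (1 ℕ.* l) ⟩
      (t ℕ.* m ℕ.* (1 ℕ.* l)) · (ξ * a)    ≈⟨ ×-congˡ (solve 3 (λ t m l →
                                                t :* m :* (con 1 :* l) := t :* (m :* l)) refl t m l) ⟩
      (t ℕ.* (m ℕ.* l)) · (ξ * a)          ≈⟨ ×-assocˡ _ t (m ℕ.* l) ⟨
      t · ((m ℕ.* l) · (ξ * a))            ≈⟨ e ⟩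
      t · ((k ℕ.* m) · (a * η))            ≈⟨ ×-assocˡ _ t (k ℕ.* m) ⟩
      (t ℕ.* (k ℕ.* m)) · (a * η)          ≈⟨ ×-congˡ (solve 3 (λ t m k →
                                                t :* (k :* m) := t :* m :* (k :* con 1)) refl t m k) ⟩
      (t ℕ.* m ℕ.* (k ℕ.* 1)) · (a * η)    ≈⟨ ×-assocˡ _ (t ℕ.* m) (k ℕ.* 1) ⟨
      (t ℕ.* m) · ((k ℕ.* 1) · (a * η))    ∎))

-- Rational numbers

-- `ℚ./` normalises its result, so the sides do not agree by computation for variable `i` and `j`.
-- Among unnormalised fractions the claim is a cross-multiplication.
/1-homo-+ : ∀ i j → (i ℤ.+ j) ℚ./ 1 ≡ i ℚ./ 1 ℚ.+ j ℚ./ 1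
/1-homo-+ i j = ℚₚ.toℚᵘ-injective (begin
  toℚᵘ ((i ℤ.+ j) ℚ./ 1)                ≈⟨ ℚₚ.toℚᵘ-fromℚᵘ (mkℚᵘ (i ℤ.+ j) 0) ⟩
  mkℚᵘ (i ℤ.+ j) 0                      ≈⟨ *≡* (cong (ℤ._* ℤ.+ 1)
                                             (cong₂ ℤ._+_ (ℤₚ.*-identityʳ i) (ℤₚ.*-identityʳ j))) ⟨
  mkℚᵘ i 0 ℚᵘ.+ mkℚᵘ j 0                ≈⟨ ℚᵘₚ.+-cong (ℚₚ.toℚᵘ-fromℚᵘ (mkℚᵘ i 0))
                                                     (ℚₚ.toℚᵘ-fromℚᵘ (mkℚᵘ j 0)) ⟨
  toℚᵘ (i ℚ./ 1) ℚᵘ.+ toℚᵘ (j ℚ./ 1)    ≈⟨ ℚₚ.toℚᵘ-homo-+ (i ℚ./ 1) (j ℚ./ 1) ⟨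
  toℚᵘ (i ℚ./ 1 ℚ.+ j ℚ./ 1)            ∎)
  where open SetoidReasoning ℚᵘₚ.≃-setoid

-- This turns a rational into an integer and so reduces linearity over ℚ to linearity over ℤ.
*-denominator : ∀ q → (↧ q) ℚ./ 1 ℚ.* q ≡ (↥ q) ℚ./ 1
*-denominator q@(ℚ.mkℚ n d _) = ℚₚ.toℚᵘ-injective (begin
  toℚᵘ ((↧ q) ℚ./ 1 ℚ.* q)              ≈⟨ ℚₚ.toℚᵘ-homo-* ((↧ q) ℚ./ 1) q ⟩
  toℚᵘ ((↧ q) ℚ./ 1) ℚᵘ.* toℚᵘ q        ≈⟨ ℚᵘₚ.*-cong (ℚₚ.toℚᵘ-fromℚᵘ (mkℚᵘ (↧ q) 0)) ℚᵘₚ.≃-refl ⟩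
  mkℚᵘ (↧ q) 0 ℚᵘ.* toℚᵘ q              ≈⟨ *≡* (trans (ℤₚ.*-identityʳ _) (trans (ℤₚ.*-comm (↧ q) n)
                                             (cong (λ k → n ℤ.* ℤ.+ suc k) (sym (ℕₚ.+-identityʳ d))))) ⟩
  mkℚᵘ (↥ q) 0                          ≈⟨ ℚₚ.toℚᵘ-fromℚᵘ (mkℚᵘ (↥ q) 0) ⟨
  toℚᵘ ((↥ q) ℚ./ 1)                    ∎)
  where open SetoidReasoning ℚᵘₚ.≃-setoid

*-cancelˡ-≢0 : ∀ p {q r} → p ≢ 0ℚ → p ℚ.* q ≡ p ℚ.* r → q ≡ r
*-cancelˡ-≢0 p {q} {r} p≢0 pq≡pr = begin
  q                      ≡⟨ unscale q ⟨
  ℚ.1/ p ℚ.* (p ℚ.* q)   ≡⟨ cong (ℚ.1/ p ℚ.*_) pq≡pr ⟩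
  ℚ.1/ p ℚ.* (p ℚ.* r)   ≡⟨ unscale r ⟩
  r                      ∎
  where
  open ≡-Reasoning
  instance _ = ℚ.≢-nonZero p≢0
  unscale : ∀ x → ℚ.1/ p ℚ.* (p ℚ.* x) ≡ x
  unscale x = trans (sym (ℚₚ.*-assoc (ℚ.1/ p) p x))
                (trans (cong (ℚ._* x) (ℚₚ.*-inverseˡ p)) (ℚₚ.*-identityˡ x))

*-≢0 : ∀ {p q} → p ≢ 0ℚ → q ≢ 0ℚ → p ℚ.* q ≢ 0ℚ
*-≢0 {p} p≢0 q≢0 pq≡0 = q≢0 (*-cancelˡ-≢0 p p≢0 (trans pq≡0 (sym (ℚₚ.*-zeroʳ p))))

module _ (h : ℚ → ℚ) (h-+ : ∀ u v → h (u ℚ.+ v) ≡ h u ℚ.+ h v) where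
  open ≡-Reasoning
  open GroupProperties ℚₚ.+-0-group using (identityˡ-unique; inverseˡ-unique)

  private
    h-0 : h 0ℚ ≡ 0ℚ
    h-0 = identityˡ-unique (h 0ℚ) (h 0ℚ) (sym (h-+ 0ℚ 0ℚ))

    h-neg : ∀ u → h (ℚ.- u) ≡ ℚ.- h u
    h-neg u = inverseˡ-unique (h (ℚ.- u)) (h u)
      (trans (sym (h-+ (ℚ.- u) u)) (trans (cong h (ℚₚ.+-inverseˡ u)) h-0))

    suc-* : ∀ n u → (ℤ.+ suc n) ℚ./ 1 ℚ.* u ≡ u ℚ.+ (ℤ.+ n) ℚ./ 1 ℚ.* u
    suc-* n u = begin
      (ℤ.+ suc n) ℚ./ 1 ℚ.* u           ≡⟨ cong (ℚ._* u) (/1-homo-+ (ℤ.+ 1) (ℤ.+ n)) ⟩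
      (1ℚ ℚ.+ (ℤ.+ n) ℚ./ 1) ℚ.* u      ≡⟨ ℚₚ.*-distribʳ-+ u 1ℚ ((ℤ.+ n) ℚ./ 1) ⟩
      1ℚ ℚ.* u ℚ.+ (ℤ.+ n) ℚ./ 1 ℚ.* u  ≡⟨ cong (ℚ._+ ((ℤ.+ n) ℚ./ 1 ℚ.* u)) (ℚₚ.*-identityˡ u) ⟩
      u ℚ.+ (ℤ.+ n) ℚ./ 1 ℚ.* u         ∎

    h-ℕ : ∀ n u → h ((ℤ.+ n) ℚ./ 1 ℚ.* u) ≡ (ℤ.+ n) ℚ./ 1 ℚ.* h u
    h-ℕ zero u = trans (cong h (ℚₚ.*-zeroˡ u)) (trans h-0 (sym (ℚₚ.*-zeroˡ (h u))))
    h-ℕ (suc n) u = begin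
      h ((ℤ.+ suc n) ℚ./ 1 ℚ.* u)      ≡⟨ cong h (suc-* n u) ⟩
      h (u ℚ.+ (ℤ.+ n) ℚ./ 1 ℚ.* u)    ≡⟨ h-+ u _ ⟩
      h u ℚ.+ h ((ℤ.+ n) ℚ./ 1 ℚ.* u)  ≡⟨ cong (h u ℚ.+_) (h-ℕ n u) ⟩
      h u ℚ.+ (ℤ.+ n) ℚ./ 1 ℚ.* h u    ≡⟨ suc-* n (h u) ⟨
      (ℤ.+ suc n) ℚ./ 1 ℚ.* h u        ∎

    h-ℤ : ∀ i u → h (i ℚ./ 1 ℚ.* u) ≡ i ℚ./ 1 ℚ.* h u
    h-ℤ (ℤ.+ n) u = h-ℕ n u
    -- `-[1+ n ] ℚ./ 1` computes to `ℚ.- m`, so the chain may start from the negated form.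
    h-ℤ -[1+ n ] u = begin
      h (ℚ.- m ℚ.* u)      ≡⟨ cong h (ℚₚ.neg-distribˡ-* m u) ⟨
      h (ℚ.- (m ℚ.* u))    ≡⟨ h-neg (m ℚ.* u) ⟩
      ℚ.- h (m ℚ.* u)      ≡⟨ cong ℚ.-_ (h-ℕ (suc n) u) ⟩
      ℚ.- (m ℚ.* h u)      ≡⟨ ℚₚ.neg-distribˡ-* m (h u) ⟩
      ℚ.- m ℚ.* h u        ∎
      where m = (ℤ.+ suc n) ℚ./ 1

  -- Multiplied by the denominator of `u`, both sides become the numerator of `u` times `h 1ℚ`, by
  -- homogeneity over ℤ. The denominator is nonzero and cancels.
  additive⇒linear : ∀ u → h u ≡ u ℚ.* h 1ℚ
  additive⇒linear u = *-cancelˡ-≢0 D D≢0 (begin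
    D ℚ.* h u                      ≡⟨ h-ℤ (↧ u) u ⟨
    h (D ℚ.* u)                    ≡⟨ cong h (*-denominator u) ⟩
    h ((↥ u) ℚ./ 1)                ≡⟨ cong h (ℚₚ.*-identityʳ _) ⟨
    h ((↥ u) ℚ./ 1 ℚ.* 1ℚ)         ≡⟨ h-ℤ (↥ u) 1ℚ ⟩
    (↥ u) ℚ./ 1 ℚ.* h 1ℚ           ≡⟨ cong (ℚ._* h 1ℚ) (*-denominator u) ⟨
    D ℚ.* u ℚ.* h 1ℚ               ≡⟨ ℚₚ.*-assoc D u (h 1ℚ) ⟩
    D ℚ.* (u ℚ.* h 1ℚ)             ∎)
    where
    D = (↧ u) ℚ./ 1
    D≢0 : D ≢ 0ℚ
    D≢0 D≡0 = ℚₚ.<⇒≢ (ℚₚ.positive⁻¹ D {{ℚₚ.normalize-pos (ℚ.↧ₙ u) 1}}) (sym D≡0)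

square-positive : ∀ {p} → p ≢ 0ℚ → 0ℚ ℚ.< p ℚ.* p
square-positive {p} p≢0 with ℚₚ.<-cmp p 0ℚ
... | tri< p<0 _ _ = ℚₚ.positive⁻¹ _ {{ℚₚ.neg*neg⇒pos p {{ℚ.negative p<0}} p {{ℚ.negative p<0}}}}
... | tri≈ _ p≡0 _ = contradiction p≡0 p≢0
... | tri> _ _ p>0 = ℚₚ.positive⁻¹ _ {{ℚₚ.pos*pos⇒pos p {{ℚ.positive p>0}} p {{ℚ.positive p>0}}}}

-- Quaternions

module _ {a b : ℚ} where
  open RawRing (Quaternion-rawRing a b) using (_+_; _*_; 0#; 1#)

  scalar : ℚ → Quaternion a b
  scalar u = quat u 0ℚ 0ℚ 0ℚ

  quat-cong : ∀ {t t′ x x′ y y′ z z′} → t ≡ t′ → x ≡ x′ → y ≡ y′ → z ≡ z′ →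
              quat {a} {b} t x y z ≡ quat t′ x′ y′ z′
  quat-cong refl refl refl refl = refl

  scalar-* : ∀ u t x y z → scalar u * quat t x y z ≡
             quat (u ℚ.* t) (u ℚ.* x) (u ℚ.* y) (u ℚ.* z)
  scalar-* u t x y z = quat-cong
    (solve 7 (λ a b u t x y z →
       u :* t :+ a :* (O :* x) :+ b :* (O :* y) :- a :* (b :* (O :* z)) := u :* t) refl a b u t x y z)
    (solve 7 (λ a b u t x y z →
       u :* x :+ O :* t :+ b :* (O :* y) :- b :* (O :* z) := u :* x) refl a b u t x y z)
    (solve 7 (λ a b u t x y z →
       u :* y :+ O :* t :+ a :* (O :* z) :- a :* (O :* x) := u :* y) refl a b u t x y z)
    (solve 7 (λ a b u t x y z →
       u :* z :+ O :* t :+ O :* y :- O :* x := u :* z) refl a b u t x y z)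
    where
    open ℚ-Solver
    O : ∀ {n} → Polynomial n
    O = con 0ℚ

  scalar+scalar* : ∀ u v x y z → scalar u + scalar v * quat 0ℚ x y z ≡
                   quat u (v ℚ.* x) (v ℚ.* y) (v ℚ.* z)
  scalar+scalar* u v x y z = trans (cong (scalar u +_) (scalar-* v 0ℚ x y z)) (quat-cong
    (trans (cong (u ℚ.+_) (ℚₚ.*-zeroʳ v)) (ℚₚ.+-identityʳ u))
    (ℚₚ.+-identityˡ _) (ℚₚ.+-identityˡ _) (ℚₚ.+-identityˡ _))

  -- The scalar part of the product of two pure quaternions.
  ⟨_,_⟩ : (q r : Quaternion a b) → ℚ
  ⟨ quat _ x y z , quat _ x′ y′ z′ ⟩ =
    a ℚ.* (x ℚ.* x′) ℚ.+ b ℚ.* (y ℚ.* y′) ℚ.- a ℚ.* (b ℚ.* (z ℚ.* z′))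

  -- For pure quaternions, `qr + rq` is the scalar `2⟨ q , r ⟩`. Orthogonal ones therefore
  -- anticommute, and moving `r` across `u + vq` flips the sign of `v`.
  orthogonal⇒conjugates : ∀ u v q r → Quaternion.t q ≡ 0ℚ → Quaternion.t r ≡ 0ℚ → ⟨ q , r ⟩ ≡ 0ℚ →
    (scalar u + scalar (ℚ.- v) * q) * r ≡ r * (scalar u + scalar v * q)
  orthogonal⇒conjugates u v q@(quat _ x y z) r@(quat _ x′ y′ z′) refl refl ⟨q,r⟩≡0 = begin
    (scalar u + scalar (ℚ.- v) * q) * r
      ≡⟨ cong (_* r) (scalar+scalar* u (ℚ.- v) x y z) ⟩
    quat u (ℚ.- v ℚ.* x) (ℚ.- v ℚ.* y) (ℚ.- v ℚ.* z) * r
      ≡⟨ quat-cong scalarPart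
           (solve 10 (λ a b u v x y z x′ y′ z′ →
              u :* x′ :+ :- v :* x :* O :+ b :* (:- v :* z :* y′) :- b :* (:- v :* y :* z′) :=
              O :* (v :* x) :+ x′ :* u :+ b :* (z′ :* (v :* y)) :- b :* (y′ :* (v :* z)))
              refl a b u v x y z x′ y′ z′)
           (solve 10 (λ a b u v x y z x′ y′ z′ →
              u :* y′ :+ :- v :* y :* O :+ a :* (:- v :* x :* z′) :- a :* (:- v :* z :* x′) :=
              O :* (v :* y) :+ y′ :* u :+ a :* (x′ :* (v :* z)) :- a :* (z′ :* (v :* x)))
              refl a b u v x y z x′ y′ z′)
           (solve 10 (λ a b u v x y z x′ y′ z′ →
              u :* z′ :+ :- v :* z :* O :+ :- v :* x :* y′ :- :- v :* y :* x′ :=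
              O :* (v :* z) :+ z′ :* u :+ x′ :* (v :* y) :- y′ :* (v :* x))
              refl a b u v x y z x′ y′ z′) ⟩
    r * quat u (v ℚ.* x) (v ℚ.* y) (v ℚ.* z)
      ≡⟨ cong (r *_) (scalar+scalar* u v x y z) ⟨
    r * (scalar u + scalar v * q) ∎
    where
    open ≡-Reasoning
    open ℚ-Solver
    O : ∀ {n} → Polynomial n
    O = con 0ℚ
    -- The other three coordinates agree as polynomials. The scalar parts are `-v⟨ q , r ⟩` and
    -- `v⟨ q , r ⟩`, so this is where orthogonality enters.
    scalarPart : Quaternion.t (quat u (ℚ.- v ℚ.* x) (ℚ.- v ℚ.* y) (ℚ.- v ℚ.* z) * r) ≡
                 Quaternion.t (r * quat u (v ℚ.* x) (v ℚ.* y) (v ℚ.* z))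
    scalarPart = begin
      _                        ≡⟨ solve 10 (λ a b u v x y z x′ y′ z′ →
                                    u :* O :+ a :* (:- v :* x :* x′) :+ b :* (:- v :* y :* y′)
                                      :- a :* (b :* (:- v :* z :* z′)) :=
                                    :- v :* (a :* (x :* x′) :+ b :* (y :* y′) :- a :* (b :* (z :* z′))))
                                    refl a b u v x y z x′ y′ z′ ⟩
      ℚ.- v ℚ.* ⟨ q , r ⟩      ≡⟨ cong (ℚ.- v ℚ.*_) ⟨q,r⟩≡0 ⟩
      ℚ.- v ℚ.* 0ℚ             ≡⟨ ℚₚ.*-zeroʳ (ℚ.- v) ⟩
      0ℚ                       ≡⟨ ℚₚ.*-zeroʳ v ⟨
      v ℚ.* 0ℚ                 ≡⟨ cong (v ℚ.*_) ⟨q,r⟩≡0 ⟨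
      v ℚ.* ⟨ q , r ⟩          ≡⟨ solve 10 (λ a b u v x y z x′ y′ z′ →
                                    v :* (a :* (x :* x′) :+ b :* (y :* y′) :- a :* (b :* (z :* z′))) :=
                                    O :* u :+ a :* (x′ :* (v :* x)) :+ b :* (y′ :* (v :* y))
                                      :- a :* (b :* (z′ :* (v :* z))))
                                    refl a b u v x y z x′ y′ z′ ⟩
      _                        ∎

  -- Orthogonality is one linear equation in three unknowns; a solution is already found in the
  -- plane spanned by i and j.
  ∃-orthogonal : b ≢ 0ℚ → ∀ q → ∃ λ r → Quaternion.t r ≡ 0ℚ × r ≢ 0# × ⟨ q , r ⟩ ≡ 0ℚ
  ∃-orthogonal b≢0 (quat _ x y z) with y ℚₚ.≟ 0ℚ
  -- Pairing with j gives `b y`, which vanishes here.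
  ... | yes y≡0 = quat 0ℚ 0ℚ 1ℚ 0ℚ , refl , (λ ()) , (begin
    a ℚ.* (x ℚ.* 0ℚ) ℚ.+ b ℚ.* (y ℚ.* 1ℚ) ℚ.- a ℚ.* (b ℚ.* (z ℚ.* 0ℚ))
      ≡⟨ solve 5 (λ a b x y z → a :* (x :* con 0ℚ) :+ b :* (y :* con 1ℚ)
                    :- a :* (b :* (z :* con 0ℚ)) := b :* y) refl a b x y z ⟩
    b ℚ.* y    ≡⟨ cong (b ℚ.*_) y≡0 ⟩
    b ℚ.* 0ℚ   ≡⟨ ℚₚ.*-zeroʳ b ⟩
    0ℚ         ∎)
    where
    open ≡-Reasoning
    open ℚ-Solver
  -- On that plane the form has coefficients `a x` and `b y`. Swapping them and negating one gives a
  -- solution, nonzero because `b y` is.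
  ... | no y≢0 = quat 0ℚ (b ℚ.* y) (ℚ.- (a ℚ.* x)) 0ℚ , refl ,
    *-≢0 b≢0 y≢0 ∘ cong Quaternion.x ,
    solve 5 (λ a b x y z → a :* (x :* (b :* y)) :+ b :* (y :* :- (a :* x))
               :- a :* (b :* (z :* con 0ℚ)) := con 0ℚ) refl a b x y z
    where open ℚ-Solver

  -- If `t` were nonzero, the vector part of `q * q`, which is `2t` times that of `q`, could vanish
  -- only for scalar `q`. Then `e` would be the positive square of `t`.
  √negative-pure : ∀ {e} q → e ℚ.< 0ℚ → q * q ≡ scalar e → Quaternion.t q ≡ 0ℚ
  √negative-pure {e} (quat t x y z) e<0 q²≡e with t ℚₚ.≟ 0ℚ
  ... | yes t≡0 = t≡0
  ... | no t≢0  = contradiction t²≡e (ℚₚ.<⇒≢ (ℚₚ.<-trans e<0 (square-positive t≢0)) ∘ sym)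
    where
    open ℚ-Solver
    2≢0 : 1ℚ ℚ.+ 1ℚ ≢ 0ℚ
    2≢0 ()

    vanishes : ∀ {w} → (1ℚ ℚ.+ 1ℚ) ℚ.* t ℚ.* w ≡ 0ℚ → w ≡ 0ℚ
    vanishes {w} e = *-cancelˡ-≢0 ((1ℚ ℚ.+ 1ℚ) ℚ.* t) (*-≢0 2≢0 t≢0)
      (trans e (sym (ℚₚ.*-zeroʳ ((1ℚ ℚ.+ 1ℚ) ℚ.* t))))

    x≡0 : x ≡ 0ℚ
    x≡0 = vanishes (trans (solve 5 (λ b t x y z →
      (con 1ℚ :+ con 1ℚ) :* t :* x := t :* x :+ x :* t :+ b :* (z :* y) :- b :* (y :* z))
      refl b t x y z) (cong Quaternion.x q²≡e))

    y≡0 : y ≡ 0ℚ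
    y≡0 = vanishes (trans (solve 5 (λ a t x y z →
      (con 1ℚ :+ con 1ℚ) :* t :* y := t :* y :+ y :* t :+ a :* (x :* z) :- a :* (z :* x))
      refl a t x y z) (cong Quaternion.y q²≡e))

    z≡0 : z ≡ 0ℚ
    z≡0 = vanishes (trans (solve 4 (λ t x y z →
      (con 1ℚ :+ con 1ℚ) :* t :* z := t :* z :+ z :* t :+ x :* y :- y :* x)
      refl t x y z) (cong Quaternion.z q²≡e))

    t²≡e : t ℚ.* t ≡ e
    t²≡e = trans (trans
      (solve 3 (λ a b t → t :* t := t :* t :+ a :* (con 0ℚ :* con 0ℚ) :+ b :* (con 0ℚ :* con 0ℚ)
                  :- a :* (b :* (con 0ℚ :* con 0ℚ))) refl a b t)
      (cong Quaternion.t (sym (cong₂ _*_ q≡t q≡t)))) (cong Quaternion.t q²≡e)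
      where
      q≡t : quat t x y z ≡ scalar t
      q≡t = quat-cong refl x≡0 y≡0 z≡0

-- Orientations

module _ {a b : ℚ} {d : ℕ} (g : ℚ[√- d ] → Quaternion a b) where
  private
    module K = RawRing ℚ[√- d ]-rawRing
    module H = RawRing (Quaternion-rawRing a b)

  module _ (g-+ : ∀ x y → g (x K.+ y) ≡ g x H.+ g y)
           (g-* : ∀ x y → g (x K.* y) ≡ g x H.* g y)
           (g-1 : g K.1# ≡ H.1#) where

    -- Each coordinate is linear in `u`, hence determined by its value at 1; the coordinates of
    -- `H.1#` are 1, 0, 0, 0.
    hom-ℚ : ∀ u → g (u + 0ℚ √) ≡ scalar u
    hom-ℚ u = quat-cong
      (trans (linear Quaternion.t (λ _ _ → refl)) (ℚₚ.*-identityʳ u))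
      (trans (linear Quaternion.x (λ _ _ → refl)) (ℚₚ.*-zeroʳ u))
      (trans (linear Quaternion.y (λ _ _ → refl)) (ℚₚ.*-zeroʳ u))
      (trans (linear Quaternion.z (λ _ _ → refl)) (ℚₚ.*-zeroʳ u))
      where
      linear : (π : Quaternion a b → ℚ) → (∀ q r → π (q H.+ r) ≡ π q ℚ.+ π r) →
               π (g (u + 0ℚ √)) ≡ u ℚ.* π H.1#
      linear π π-+ = trans
        (additive⇒linear (λ v → π (g (v + 0ℚ √)))
          (λ v w → trans (cong π (g-+ (v + 0ℚ √) (w + 0ℚ √))) (π-+ _ _)) u)
        (cong (λ q → u ℚ.* π q) g-1)

    private
      D = (ℤ.+ d) ℚ./ 1
      √-d : ℚ[√- d ]
      √-d = 0ℚ + 1ℚ √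

    hom-expand : ∀ u v → g (u + v √) ≡ scalar u H.+ scalar v H.* g √-d
    hom-expand u v = begin
      g (u + v √)                                    ≡⟨ cong g (cong₂ _+_√ real imaginary) ⟩
      g ((u + 0ℚ √) K.+ (v + 0ℚ √) K.* √-d)          ≡⟨ g-+ _ _ ⟩
      g (u + 0ℚ √) H.+ g ((v + 0ℚ √) K.* √-d)        ≡⟨ cong (g (u + 0ℚ √) H.+_) (g-* (v + 0ℚ √) √-d) ⟩
      g (u + 0ℚ √) H.+ g (v + 0ℚ √) H.* g √-d        ≡⟨ cong₂ (λ q r → q H.+ r H.* g √-d) (hom-ℚ u) (hom-ℚ v) ⟩
      scalar u H.+ scalar v H.* g √-d                ∎
      where
      open ≡-Reasoning
      open ℚ-Solver
      -- These are the unsimplified coordinates of `(u + 0ℚ √) K.+ (v + 0ℚ √) K.* √-d`.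
      real : u ≡ u ℚ.+ (v ℚ.* 0ℚ ℚ.- D ℚ.* (0ℚ ℚ.* 1ℚ))
      real = solve 3 (λ u v D → u := u :+ (v :* con 0ℚ :- D :* (con 0ℚ :* con 1ℚ))) refl u v D
      imaginary : v ≡ 0ℚ ℚ.+ (v ℚ.* 1ℚ ℚ.+ 0ℚ ℚ.* 0ℚ)
      imaginary = solve 1 (λ v → v := con 0ℚ :+ (v :* con 1ℚ :+ con 0ℚ :* con 0ℚ)) refl v

    hom-√-pure : .{{_ : NonZero d}} → Quaternion.t (g √-d) ≡ 0ℚ
    hom-√-pure = √negative-pure (g √-d)
      (ℚₚ.neg-antimono-< (ℚₚ.positive⁻¹ D {{ℚₚ.normalize-pos d 1}}))
      (begin
        g √-d H.* g √-d       ≡⟨ g-* √-d √-d ⟨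
        -- The imaginary part of the square is a closed term that computes to `0ℚ`, so only the real
        -- part is rewritten.
        g (√-d K.* √-d)       ≡⟨ cong (λ u → g (u + 0ℚ √))
                                   (trans (ℚₚ.+-identityˡ _) (cong ℚ.-_ (ℚₚ.*-identityʳ D))) ⟩
        g ((ℚ.- D) + 0ℚ √)    ≡⟨ hom-ℚ (ℚ.- D) ⟩
        scalar (ℚ.- D)        ∎)
      where open ≡-Reasoning

    -- By `hom-expand` all values of `g` lie in the span of 1 and `g √-d`, so a single `β`
    -- orthogonal to `g √-d` serves every `x`.
    ∃-conjugating : .{{_ : NonZero d}} → b ≢ 0ℚ →
                    ∃ λ β → β ≢ H.0# × (∀ x → g (conj x) H.* β ≡ β H.* g x)
    ∃-conjugating b≢0 =
      let β , β-pure , β≢0 , orthogonal = ∃-orthogonal b≢0 (g √-d) in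
      β , β≢0 , λ { (u + v √) → begin
        g (u + (ℚ.- v) √) H.* β                                ≡⟨ cong (H._* β) (hom-expand u (ℚ.- v)) ⟩
        (scalar u H.+ scalar (ℚ.- v) H.* g √-d) H.* β          ≡⟨ orthogonal⇒conjugates u v (g √-d) β
                                                                    hom-√-pure β-pure orthogonal ⟩
        β H.* (scalar u H.+ scalar v H.* g √-d)                ≡⟨ cong (β H.*_) (hom-expand u v) ⟨
        β H.* g (u + v √)                                      ∎ }
      where open ≡-Reasoning

-- Transport from the quaternion algebra to fractions of a ring

module _ (R : Ring c ℓ) {a b : ℚ} {d : ℕ} where
  private
    module K = RawRing ℚ[√- d ]-rawRing
    module H = RawRing (Quaternion-rawRing a b)
  open RawRing (R ⊗ℚ) using ()
    renaming (Carrier to Rℚ; _≈_ to _≈ℚ_; _+_ to _+ℚ_; _*_ to _*ℚ_; 0# to 0ℚ#; 1# to 1ℚ#)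
  open RingMorphisms
  open SetoidReasoning (⊗ℚ-setoid R)

  -- The argument is purely ring-theoretic: the curve enters only through its endomorphism ring,
  -- taken later as `R`.
  ∃-conjugating-⊗ℚ : .{{_ : NonZero d}} → b ≢ 0ℚ →
    {f : Quaternion a b → Rℚ} → IsRingIsomorphism (Quaternion-rawRing a b) (R ⊗ℚ) f →
    {ι : ℚ[√- d ] → Rℚ} → IsRingHomomorphism ℚ[√- d ]-rawRing (R ⊗ℚ) ι →
    ∃ λ α → ¬ Ring._≈_ R α (Ring.0# R) × (∀ x → (ι (conj x) *ℚ (α / 1)) ≈ℚ ((α / 1) *ℚ ι x))
  ∃-conjugating-⊗ℚ b≢0 {f} f-iso {ι} ι-hom = α , α≉0 , twists
    where
    module f = IsRingIsomorphism f-iso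
    module ι = IsRingHomomorphism ι-hom

    -- `g` is `ι` followed by the inverse of `f`: surjectivity supplies the values, and injectivity
    -- the homomorphism laws below.
    g : ℚ[√- d ] → Quaternion a b
    g x = proj₁ (f.surjective (ι x))

    f∘g : ∀ x → _≃_ R (f (g x)) (ι x)
    f∘g x = equal (proj₂ (f.surjective (ι x)) refl)

    g-+ : ∀ x y → g (x K.+ y) ≡ g x H.+ g y
    g-+ x y = f.injective (equality (begin
      f (g (x K.+ y))       ≈⟨ f∘g (x K.+ y) ⟩
      ι (x K.+ y)           ≈⟨ equal (ι.+-homo x y) ⟩
      ι x +ℚ ι y            ≈⟨ ⊗ℚ-+-cong R (f∘g x) (f∘g y) ⟨
      f (g x) +ℚ f (g y)    ≈⟨ equal (f.+-homo (g x) (g y)) ⟨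
      f (g x H.+ g y)       ∎))

    g-* : ∀ x y → g (x K.* y) ≡ g x H.* g y
    g-* x y = f.injective (equality (begin
      f (g (x K.* y))       ≈⟨ f∘g (x K.* y) ⟩
      ι (x K.* y)           ≈⟨ equal (ι.*-homo x y) ⟩
      ι x *ℚ ι y            ≈⟨ ⊗ℚ-*-cong R (f∘g x) (f∘g y) ⟨
      f (g x) *ℚ f (g y)    ≈⟨ equal (f.*-homo (g x) (g y)) ⟨
      f (g x H.* g y)       ∎))

    g-1 : g K.1# ≡ H.1#
    g-1 = f.injective (equality (begin
      f (g K.1#)  ≈⟨ f∘g K.1# ⟩
      ι K.1#      ≈⟨ equal ι.1#-homo ⟩
      1ℚ#         ≈⟨ equal f.1#-homo ⟨
      f H.1#      ∎))

    conjugating = ∃-conjugating g g-+ g-* g-1 b≢0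
    β = proj₁ conjugating
    -- `f β` lies only in `R ⊗ℚ`; its numerator is an honest element of `R` and satisfies the same
    -- relation by `clear-denominator`.
    α = Fraction.num (f β)

    α≉0 : ¬ Ring._≈_ R α (Ring.0# R)
    α≉0 α≈0 = proj₁ (proj₂ conjugating) (f.injective (equality (begin
      f β     ≈⟨ num≈0⇒≈0 R (f β) α≈0 ⟩
      0ℚ#     ≈⟨ equal f.0#-homo ⟨
      f H.0#  ∎)))

    twists : ∀ x → (ι (conj x) *ℚ (α / 1)) ≈ℚ ((α / 1) *ℚ ι x)
    twists x = equality (clear-denominator R {ι (conj x)} {ι x} (f β) (begin
      ι (conj x) *ℚ f β      ≈⟨ ⊗ℚ-*-cong R (f∘g (conj x)) (⊗ℚ-refl R {f β}) ⟨
      f (g (conj x)) *ℚ f β  ≈⟨ equal (f.*-homo (g (conj x)) β) ⟨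
      f (g (conj x) H.* β)   ≈⟨ equal (f.⟦⟧-cong (proj₂ (proj₂ conjugating) x)) ⟩
      f (β H.* g x)          ≈⟨ equal (f.*-homo β (g x)) ⟩
      f β *ℚ f (g x)         ≈⟨ ⊗ℚ-*-cong R (⊗ℚ-refl R {f β}) (f∘g x) ⟩
      f β *ℚ ι x             ∎))

theorem2p11 : ∀ {c ℓ} (p : ℕ) → Prime p → 3 < p → (k : AlgebraicClosure-𝔽 p c ℓ) →
    (d : ℕ) → .{{_ : NonZero d}} → ¬ SplitsIn p d →
    (ω : ℚ[√- d ]) → IsOrder ℤ[ ω ] →
    (E : EllipticCurve k) → Supersingular k E →
    (o : Orientation k E d) → Primitive k E o ℤ[ ω ] →
    ∃ λ (α : Endomorphism k E) →
      (¬ Ring._≈_ (End k E) α (Ring.0# (End k E))) × IsTwisting k E o ω α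
theorem2p11 p _ _ k d _ ω _ E (a , b , _ , b<0 , f , f-iso) o _ =
  -- Definiteness gives `b < 0`, hence `b ≢ 0ℚ`. The relation holds on all of the field and is
  -- specialised to `ω`.
  let α , α≉0 , twists = ∃-conjugating-⊗ℚ (End k E) (ℚₚ.<⇒≢ b<0) f-iso ι.isRingHomomorphism
  in α , α≉0 , twists ω
  where module ι = RingMorphisms.IsRingMonomorphism (Orientation.isRingMonomorphism o)
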